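{- The MHV problem can be approximated within a factor of $\Omega(\Delta^{ -3})$ in polynomial time, where $\Delta$ is the maximum degree of vertices in the input graph. That is, there exist an absolute constant $\alpha>0$ and a polynomial-time algorithm which, on every MHV instance whose graph has maximum degree $\Delta\ge 1$, outputs a total vertex coloring extending the given partial coloring whose number of happy vertices is at least $\alpha\,\Delta^{ -3}\cdot OPT$, where $OPT$ is the maximum number of happy vertices over all total colorings extending the given partial coloring.
   Context: Maximum Happy Vertices problem (MHV): an instance consists of an undirected graph $G=(V,E)$, a color set $C=\{1,2,\ldots,k\}$ ($k$ is part of the input), and a partial vertex coloring $c\colon V\to C$ (i.e. $c$ assigns colors to only part of the vertices). A total vertex coloring $c'\colon V\to C$ extends $c$ if it agrees with $c$ wherever $c$ is defined. Under a total coloring, a vertex is happy if it has the same color as all of its neighbors, and unhappy otherwise. The task is to find a total coloring extending $c$ that maximizes the number of happy vertices. -}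

module Defs where

open import Data.Bool.Base using (Bool; true; false; T)
open import Data.Bool.Properties using (T?)
open import Data.Fin.Base using (Fin; zero; suc; toℕ)
open import Data.Fin.Properties as Fin using (all?)
open import Data.List.Base as List
  using (List; []; _∷_; allFin; cartesianProductWith; filter; length)
open import Data.List.Extrema.Nat
  using (max; xs≤max; max≈v⁺; argmax; argmax-all; f[xs]≤f[argmax])
open import Data.List.Membership.Propositional using (_∈_)
open import Data.List.Membership.Propositional.Properties
  using (∈-map⁺; ∈-filter⁺; ∈-cartesianProductWith⁺; ∈-allFin)
import Data.List.Relation.Unary.All as All
open import Data.List.Relation.Unary.All.Properties using (all-filter; map⁺)
open import Data.List.Relation.Unary.Any using (here)
open import Data.Maybe.Base using (Maybe; just; nothing; fromMaybe)
open import Data.Maybe.Properties using (≡-dec)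
open import Data.Nat.Base
  using (ℕ; zero; suc; _+_; _*_; _^_; _≤_; z≤n; NonZero)
open import Data.Nat.Binary.Base as ℕᵇ using (ℕᵇ; 2[1+_]; 1+[2_])
open import Data.Product.Base using (∃-syntax; _×_; _,_)
open import Data.Vec.Base as Vec using (Vec; []; _∷_; lookup; _[_]≔_)
open import Data.Vec.Properties using (lookup-map)
open import Relation.Binary.PropositionalEquality
  using (_≡_; _≢_; refl; sym; trans; cong; subst)
open import Relation.Nullary using (Dec)
open import Relation.Nullary.Decidable using (_→-dec_)

record Graph (n : ℕ) : Set where
  field
    adj    : Fin n → Fin n → Bool
    symm   : ∀ u v → adj u v ≡ adj v u
    irrefl : ∀ v → adj v v ≡ false

  degree : Fin n → ℕ
  degree v = length (filter (λ u → T? (adj v u)) (allFin n))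

  maxDegree : ℕ
  maxDegree = max 0 (List.map degree (allFin n))

-- The colours 1, …, k are represented by Fin k.  There is at least one
-- colour: otherwise a nonempty graph has no total colouring at all.
record MHV : Set where
  field
    n k       : ℕ
    {{k≢0}}   : NonZero k
    graph     : Graph n
    precolour : Vec (Maybe (Fin k)) n

  open Graph graph public

  Colouring : Set
  Colouring = Vec (Fin k) n

  Extends : Colouring → Set
  Extends c = ∀ v a → lookup precolour v ≡ just a → lookup c v ≡ a

  Happy : Colouring → Fin n → Set
  Happy c v = ∀ u → T (adj v u) → lookup c u ≡ lookup c v

  extends? : ∀ c → Dec (Extends c)
  extends? c = all? λ v → all? λ a →
    ≡-dec Fin._≟_ (lookup precolour v) (just a) →-dec (lookup c v Fin.≟ a)

  happy? : ∀ c v → Dec (Happy c v)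
  happy? c v = all? λ u → T? (adj v u) →-dec (lookup c u Fin.≟ lookup c v)

  happyCount : Colouring → ℕ
  happyCount c = length (filter (happy? c) (allFin n))

allVecs : ∀ k n → List (Vec (Fin k) n)
allVecs k zero    = [] ∷ []
allVecs k (suc n) = cartesianProductWith _∷_ (allFin k) (allVecs k n)

-- The maximum number of happy vertices over all extensions; opt-attained
-- shows that the default value 0 for an empty list plays no role.
opt : MHV → ℕ
opt I = max 0 (List.map happyCount (filter extends? (allVecs k n)))
  where open MHV I

∈-allVecs : ∀ {k n} (c : Vec (Fin k) n) → c ∈ allVecs k n
∈-allVecs []      = here refl
∈-allVecs (a ∷ c) = ∈-cartesianProductWith⁺ _∷_ (∈-allFin a) (∈-allVecs c)

module _ (I : MHV) where
  open MHV I

  private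
    extensions : List Colouring
    extensions = filter extends? (allVecs k n)

    ∈-extensions : ∀ c → Extends c → c ∈ extensions
    ∈-extensions c e = ∈-filter⁺ extends? (∈-allVecs c) e

    someColour : ∀ m → {{NonZero m}} → Fin m
    someColour (suc m) = zero

    c₀ : Colouring
    c₀ = Vec.map (fromMaybe (someColour k)) precolour

    c₀-extends : Extends c₀
    c₀-extends v a eq =
      trans (lookup-map v (fromMaybe (someColour k)) precolour)
            (cong (fromMaybe (someColour k)) eq)

    best : Colouring
    best = argmax happyCount c₀ extensions

    best-extends : Extends best
    best-extends =
      argmax-all happyCount c₀-extends (all-filter extends? (allVecs k n))

  opt-upper : ∀ c → Extends c → happyCount c ≤ opt I
  opt-upper c e =
    All.lookup (xs≤max 0 (List.map happyCount extensions))
               (∈-map⁺ happyCount (∈-extensions c e))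

  opt-attained : ∃[ c ] (Extends c × happyCount c ≡ opt I)
  opt-attained = best , best-extends , sym
    (max≈v⁺ (∈-map⁺ happyCount (∈-extensions best best-extends))
            (map⁺ (f[xs]≤f[argmax] {f = happyCount} c₀ extensions))
            z≤n)

-- Algorithms are programs of the language WHILE over binary trees (Jones,
-- "Computability and Complexity from a Programming Perspective").  Programs
-- are finite syntax and the only primitives are construction, projections
-- and the test for nil.  Under the cost measure below, polynomial time
-- agrees with that of Turing machines for outputs of polynomial size (trees
-- being stored with sharing, each elementary operation is simulated in time
-- polynomial in the input size and the number of steps so far).

infixr 5 _∙_

data Tree : Set where
  nil : Tree
  _∙_ : Tree → Tree → Tree

size : Tree → ℕ
size nil     = 1
size (l ∙ r) = 1 + size l + size r

left right : Tree → Tree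
left nil      = nil
left (l ∙ r)  = l
right nil     = nil
right (l ∙ r) = r

data Expr (m : ℕ) : Set where
  var    : Fin m → Expr m
  `nil   : Expr m
  `cons  : Expr m → Expr m → Expr m
  `left  : Expr m → Expr m
  `right : Expr m → Expr m

infix  6 _:=_
infixr 5 _⨾_

data Cmd (m : ℕ) : Set where
  skip          : Cmd m
  _:=_          : Fin m → Expr m → Cmd m
  _⨾_           : Cmd m → Cmd m → Cmd m
  if_then_else_ : Expr m → Cmd m → Cmd m → Cmd m
  while_repeat_ : Expr m → Cmd m → Cmd m

Store : ℕ → Set
Store = Vec Tree

eval : ∀ {m} → Expr m → Store m → Tree
eval (var x)     σ = lookup σ x
eval `nil        σ = nil
eval (`cons d e) σ = eval d σ ∙ eval e σ
eval (`left e)   σ = left (eval e σ)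
eval (`right e)  σ = right (eval e σ)

cost : ∀ {m} → Expr m → ℕ
cost (var x)     = 1
cost `nil        = 1
cost (`cons d e) = 1 + cost d + cost e
cost (`left e)   = 1 + cost e
cost (`right e)  = 1 + cost e

-- ⟨ C , σ ⟩⇓ τ [ t ]: run from the store σ, the command C halts in the
-- store τ after t steps.  As conditions, nil is false and all other trees
-- are true.
infix 4 ⟨_,_⟩⇓_[_]

data ⟨_,_⟩⇓_[_] {m : ℕ} : Cmd m → Store m → Store m → ℕ → Set where
  skip    : ∀ {σ} → ⟨ skip , σ ⟩⇓ σ [ 1 ]
  assign  : ∀ {x e σ} →
            ⟨ x := e , σ ⟩⇓ (σ [ x ]≔ eval e σ) [ 1 + cost e ]
  seq     : ∀ {C D ρ σ τ s t} →
            ⟨ C , ρ ⟩⇓ σ [ s ] → ⟨ D , σ ⟩⇓ τ [ t ] →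
            ⟨ C ⨾ D , ρ ⟩⇓ τ [ 1 + s + t ]
  ifTrue  : ∀ {e C D σ τ t} → eval e σ ≢ nil → ⟨ C , σ ⟩⇓ τ [ t ] →
            ⟨ if e then C else D , σ ⟩⇓ τ [ 1 + cost e + t ]
  ifFalse : ∀ {e C D σ τ t} → eval e σ ≡ nil → ⟨ D , σ ⟩⇓ τ [ t ] →
            ⟨ if e then C else D , σ ⟩⇓ τ [ 1 + cost e + t ]
  loop    : ∀ {e C ρ σ τ s t} → eval e ρ ≢ nil →
            ⟨ C , ρ ⟩⇓ σ [ s ] → ⟨ while e repeat C , σ ⟩⇓ τ [ t ] →
            ⟨ while e repeat C , ρ ⟩⇓ τ [ 1 + cost e + s + t ]
  exit    : ∀ {e C σ} → eval e σ ≡ nil →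
            ⟨ while e repeat C , σ ⟩⇓ σ [ 1 + cost e ]

-- Variable zero holds the input at the start and the output at the end;
-- all other variables are initially nil.
record Program : Set where
  constructor program
  field
    locals : ℕ
    body   : Cmd (suc locals)

_on_yields_within_ : Program → Tree → Tree → ℕ → Set
program l C on d yields r within t =
  ∃[ τ ] (⟨ C , d ∷ Vec.replicate l nil ⟩⇓ τ [ t ] × Vec.head τ ≡ r)

Outputs : Program → Tree → Tree → Set
Outputs P d r = ∃[ t ] P on d yields r within t

-- P halts on every input of the form encode x, in time polynomial in the
-- size of that input.  Sizes are at least 1, so every polynomial in the size
-- is dominated by some b · sizeᵉ.
PolynomialTime : {A : Set} → (A → Tree) → Program → Set
PolynomialTime {A} encode P = ∃[ b ] ∃[ e ] ∀ (x : A) →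
  ∃[ r ] ∃[ t ] (P on encode x yields r within t × t ≤ b * size (encode x) ^ e)

-- Numbers are written in binary, so that the number k of colours
-- contributes only O(log k) to the size of an instance.

encodeℕᵇ : ℕᵇ → Tree
encodeℕᵇ ℕᵇ.zero  = nil
encodeℕᵇ 2[1+ x ] = nil ∙ encodeℕᵇ x
encodeℕᵇ 1+[2 x ] = (nil ∙ nil) ∙ encodeℕᵇ x

encodeℕ : ℕ → Tree
encodeℕ m = encodeℕᵇ (ℕᵇ.fromℕ m)

encodeBool : Bool → Tree
encodeBool false = nil
encodeBool true  = nil ∙ nil

encodeMaybe : {A : Set} → (A → Tree) → Maybe A → Tree
encodeMaybe f nothing  = nil
encodeMaybe f (just x) = nil ∙ f x

encodeVec : {A : Set} {m : ℕ} → (A → Tree) → Vec A m → Tree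
encodeVec f []       = nil
encodeVec f (x ∷ xs) = f x ∙ encodeVec f xs

encodeColour : ∀ {k} → Fin k → Tree
encodeColour a = encodeℕ (toℕ a)

encodeColouring : ∀ {k n} → Vec (Fin k) n → Tree
encodeColouring = encodeVec encodeColour

encodeMHV : MHV → Tree
encodeMHV I =
    encodeVec (encodeVec encodeBool) (Vec.tabulate λ v → Vec.tabulate (adj v))
  ∙ encodeℕ k
  ∙ encodeVec (encodeMaybe encodeColour) precolour
  where open MHV I

{-# OPTIONS --safe #-}

-- A vertex is painted greedily when the colours already present in its closed
-- neighbourhood agree: the whole neighbourhood then gets that colour, and the
-- vertex stays happy because colours are never overwritten.  A vertex v that
-- is happy in an optimal colouring is passed over only if its neighbourhood
-- contains a colour that the instance does not prescribe, so that v is within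
-- distance 2 of a painted vertex.  Hence opt is at most (1 + Δ)² ≤ 4 Δ³ times
-- the number of happy vertices.
module Submission where

open import Defs
open import Data.Bool.Base using (Bool; true; false; T; _∨_)
open import Data.Fin using (#_)
open import Data.Fin.Base using (Fin; zero; suc; toℕ)
open import Data.Maybe.Base using (Maybe; just; nothing; fromMaybe)
open import Data.Nat.Base using (ℕ; zero; suc; NonZero; _^_)
open import Data.Nat.GeneralisedArithmetic using (iterate; iterate-is-fold)
open import Data.Nat.Properties using (m^n≢0)
open import Data.Product.Base using (∃-syntax; _×_; _,_; proj₁; proj₂)
open import Data.Sum.Base using (_⊎_; inj₁; inj₂)
open import Data.Vec.Base as Vec using (Vec; []; _∷_; lookup; _[_]≔_; tabulate; zipWith)
open import Function.Base using (_∘_)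
open import Relation.Binary.PropositionalEquality

-- A clash leads to a painted vertex because, of two different colours around `v`, at least one
-- differs from the colour that the optimum gives `v`. A prescribed colour cannot differ from it,
-- since the optimum respects prescriptions and `v` is happy there; so the deviating colour was put
-- there by an earlier painting. The other obstacle is running time: a WHILE loop carries no bound,
-- and nil is the only test. The algorithm therefore uses loops clocked by two read-only lists, one
-- with a cell per vertex and one with the binary digits of `k`. Expression costs do not depend on
-- tree sizes, so the loop depth alone gives the exponent. Colours are compared digit by digit, and
-- none has more digits than `k`. The constant 1/4 comes from `1 + Δ ≤ 2Δ`, which needs `Δ ≥ 1`.

-- Bounded loop programs and their compilation to WHILE

module ClockedCode where

  open import Data.Nat.Base
  open import Data.Nat.Properties

  spine : Tree → ℕ
  spine nil     = 0
  spine (l ∙ r) = suc (spine r)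

  spine≤size : ∀ t → spine t ≤ size t
  spine≤size nil     = z≤n
  spine≤size (l ∙ r) = s≤s (≤-trans (spine≤size r) (m≤n+m (size r) (size l)))

  branch : {A : Set} → Tree → A → A → A
  branch nil     x y = y
  branch (_ ∙ _) x y = x

  data Clock : Set where
    vertices digits : Clock

  infix  6 _:=_
  infixr 5 _⨾_

  -- Commands whose only loops repeat their body once per cell of one of two
  -- read-only lists, so that a running time polynomial in the lengths of these
  -- lists can be read off the syntax.
  data Code (m : ℕ) : Set where
    skip          : Code m
    _:=_          : Fin m → Expr m → Code m
    _⨾_           : Code m → Code m → Code m
    if_then_else_ : Expr m → Code m → Code m → Code m
    for           : Clock → Code m → Code m

  module _ {m : ℕ} (ticks : Clock → ℕ) where

    -- With the number of rounds fixed in advance by `ticks`, the semantics is a total function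
    -- rather than a relation.
    ⟦_⟧ : Code m → Store m → Store m
    ⟦ skip ⟧               σ = σ
    ⟦ x := e ⟧             σ = σ [ x ]≔ eval e σ
    ⟦ C ⨾ D ⟧              σ = ⟦ D ⟧ (⟦ C ⟧ σ)
    ⟦ if e then C else D ⟧ σ = branch (eval e σ) (⟦ C ⟧ σ) (⟦ D ⟧ σ)
    ⟦ for c C ⟧            σ = iterate ⟦ C ⟧ σ (ticks c)

  -- Data variables move past the stack and the two clocks, so a `Code` cannot address these; this
  -- is what makes the clocks read-only.
  shift : ∀ {m} → Expr m → Expr (3 + m)
  shift (var x)     = var (suc (suc (suc x)))
  shift `nil        = `nil
  shift (`cons d e) = `cons (shift d) (shift e)
  shift (`left e)   = `left (shift e)
  shift (`right e)  = `right (shift e)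

  clockVar : ∀ {m} → Clock → Fin (3 + m)
  clockVar vertices = suc zero
  clockVar digits   = suc (suc zero)

  -- Variable zero is a stack that holds the unread part of the clock of every
  -- active loop; this keeps nested loops over the same clock apart.
  compile : ∀ {m} → Code m → Cmd (3 + m)
  compile skip                   = skip
  compile (x := e)               = suc (suc (suc x)) := shift e
  compile (C ⨾ D)                = compile C ⨾ compile D
  compile (if e then C else D)   = if shift e then compile C else compile D
  compile (for c C)              =
    zero := `cons (var (clockVar c)) (var zero) ⨾
    (while `left (var zero) repeat
      (zero := `cons (`right (`left (var zero))) (`right (var zero)) ⨾ compile C)) ⨾
    zero := `right (var zero)

  -- Entering and leaving a loop takes 12 steps, and each round 11 steps besides
  -- those of the body.
  coeff : ∀ {m} → Code m → ℕ
  coeff skip                 = 1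
  coeff (x := e)             = 1 + cost e
  coeff (C ⨾ D)              = 1 + coeff C + coeff D
  coeff (if e then C else D) = 1 + cost e + (coeff C + coeff D)
  coeff (for c C)            = 12 + (11 + coeff C)

  -- Every loop makes at most `N` rounds, so the nesting depth of the loops is the exponent of `N`
  -- in the time bound.
  deg : ∀ {m} → Code m → ℕ
  deg skip                 = 0
  deg (x := e)             = 0
  deg (C ⨾ D)              = deg C ⊔ deg D
  deg (if e then C else D) = deg C ⊔ deg D
  deg (for c C)            = suc (deg C)

  eval-shift : ∀ {m} (e : Expr m) {S p q σ} → eval (shift e) (S ∷ p ∷ q ∷ σ) ≡ eval e σ
  eval-shift (var x)     = refl
  eval-shift `nil        = refl
  eval-shift (`cons d e) = cong₂ _∙_ (eval-shift d) (eval-shift e)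
  eval-shift (`left e)   = cong left (eval-shift e)
  eval-shift (`right e)  = cong right (eval-shift e)

  cost-shift : ∀ {m} (e : Expr m) → cost (shift e) ≡ cost e
  cost-shift (var x)     = refl
  cost-shift `nil        = refl
  cost-shift (`cons d e) = cong₂ (λ a b → 1 + a + b) (cost-shift d) (cost-shift e)
  cost-shift (`left e)   = cong suc (cost-shift e)
  cost-shift (`right e)  = cong suc (cost-shift e)

  module _ {m : ℕ} (p q : Tree) (N : ℕ) {{_ : NonZero N}}
           (p≤N : spine p ≤ N) (q≤N : spine q ≤ N) where

    clockTree : Clock → Tree
    clockTree vertices = p
    clockTree digits   = q

    ticks : Clock → ℕ
    ticks c = spine (clockTree c)

    ticks≤N : ∀ c → ticks c ≤ N
    ticks≤N vertices = p≤N
    ticks≤N digits   = q≤N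

    lookup-clock : ∀ c {S} {σ : Store m} → lookup (S ∷ p ∷ q ∷ σ) (clockVar c) ≡ clockTree c
    lookup-clock vertices = refl
    lookup-clock digits   = refl

    Runs : Cmd (3 + m) → Tree → Tree → Store m → Store m → ℕ → Set
    Runs C S S′ σ τ T = ∃[ t ] (⟨ C , S ∷ p ∷ q ∷ σ ⟩⇓ S′ ∷ p ∷ q ∷ τ [ t ] × t ≤ T)

    const≤ : ∀ a d → a ≤ a * N ^ d
    const≤ a d = m≤m*n a (N ^ d) {{m^n≢0 N d}}

    raise : ∀ a {d d′} → d ≤ d′ → a * N ^ d ≤ a * N ^ d′
    raise a d≤d′ = *-monoʳ-≤ a (^-monoʳ-≤ N d≤d′)

    -- Serves both sequences and conditionals, with `a` as the overhead; in a conditional the branch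
    -- not taken is charged 0 steps.
    pair≤ : ∀ a (C D : Code m) {s t} →
            s ≤ coeff C * N ^ deg C → t ≤ coeff D * N ^ deg D →
            a + (s + t) ≤ (a + (coeff C + coeff D)) * N ^ (deg C ⊔ deg D)
    pair≤ a C D {s} {t} s≤ t≤ = begin
      a + (s + t)
        ≤⟨ +-mono-≤ (const≤ a d)
             (+-mono-≤ (≤-trans s≤ (raise (coeff C) (m≤m⊔n (deg C) (deg D))))
                       (≤-trans t≤ (raise (coeff D) (m≤n⊔m (deg C) (deg D))))) ⟩
      a * N ^ d + (coeff C * N ^ d + coeff D * N ^ d)
        ≡⟨ cong (a * N ^ d +_) (*-distribʳ-+ (N ^ d) (coeff C) (coeff D)) ⟨
      a * N ^ d + (coeff C + coeff D) * N ^ d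
        ≡⟨ *-distribʳ-+ (N ^ d) a (coeff C + coeff D) ⟨
      (a + (coeff C + coeff D)) * N ^ d ∎
      where
      open ≤-Reasoning
      d : ℕ
      d = deg C ⊔ deg D

    for≤ : ∀ L K d → L ≤ N → 12 + L * (11 + K * N ^ d) ≤ (12 + (11 + K)) * N ^ suc d
    for≤ L K d L≤N = begin
      12 + L * (11 + K * N ^ d)
        ≤⟨ +-mono-≤ (const≤ 12 (suc d)) (*-mono-≤ L≤N (+-monoˡ-≤ (K * N ^ d) (const≤ 11 d))) ⟩
      12 * N ^ suc d + N * (11 * N ^ d + K * N ^ d)
        ≡⟨ cong (λ x → 12 * N ^ suc d + N * x) (*-distribʳ-+ (N ^ d) 11 K) ⟨
      12 * N ^ suc d + N * ((11 + K) * N ^ d)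
        ≡⟨ cong (12 * N ^ suc d +_) (x*yz N (11 + K) (N ^ d)) ⟩
      12 * N ^ suc d + (11 + K) * N ^ suc d
        ≡⟨ *-distribʳ-+ (N ^ suc d) 12 (11 + K) ⟨
      (12 + (11 + K)) * N ^ suc d ∎
      where
      open ≤-Reasoning
      x*yz : ∀ x y z → x * (y * z) ≡ y * (x * z)
      x*yz x y z = trans (sym (*-assoc x y z))
                         (trans (cong (_* z) (*-comm x y)) (*-assoc y x z))

    -- Induction on the unread cells `u`. The body is assumed to run on every stack because each
    -- round puts a different remainder beneath it; as it returns the stack it received, that
    -- remainder survives inner loops over the same clock.
    while-run : ∀ (C : Code m) T → (∀ S σ → Runs (compile C) S S σ (⟦ ticks ⟧ C σ) T) →
      ∀ u S σ →
      Runs (while `left (var zero) repeat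
             (zero := `cons (`right (`left (var zero))) (`right (var zero)) ⨾ compile C))
           (u ∙ S) (nil ∙ S) σ (iterate (⟦ ticks ⟧ C) σ (spine u)) (3 + spine u * (11 + T))
    while-run C T body nil     S σ = 3 , exit refl , ≤-refl
    while-run C T body (l ∙ r) S σ
      with s , C⇓ , s≤ ← body (r ∙ S) σ
      with t , W⇓ , t≤ ← while-run C T body r S (⟦ ticks ⟧ C σ) =
      _ , loop (λ ()) (seq assign C⇓) W⇓ , bound
      where
      open ≤-Reasoning
      bound : 1 + 2 + (1 + 7 + s) + t ≤ 3 + (11 + T + spine r * (11 + T))
      bound = begin
        11 + s + t                        ≤⟨ +-mono-≤ (+-monoʳ-≤ 11 s≤) t≤ ⟩
        11 + T + (3 + spine r * (11 + T)) ≡⟨ +-assoc (11 + T) 3 _ ⟨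
        11 + T + 3 + spine r * (11 + T)   ≡⟨ cong (_+ spine r * (11 + T)) (+-comm (11 + T) 3) ⟩
        3 + (11 + T) + spine r * (11 + T) ≡⟨ +-assoc 3 (11 + T) _ ⟩
        3 + (11 + T + spine r * (11 + T)) ∎

    compile-run : ∀ (C : Code m) S σ →
                  Runs (compile C) S S σ (⟦ ticks ⟧ C σ) (coeff C * N ^ deg C)
    compile-run skip     S σ = 1 , skip , ≤-refl
    compile-run (x := e) S σ = _ ,
      subst (λ v → ⟨ _ , _ ⟩⇓ _ ∷ _ ∷ _ ∷ (σ [ x ]≔ v) [ _ ]) (eval-shift e) assign ,
      ≤-reflexive (trans (cong suc (cost-shift e)) (sym (*-identityʳ _)))
    compile-run (C ⨾ D) S σ
      with s , C⇓ , s≤ ← compile-run C S σ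
      with t , D⇓ , t≤ ← compile-run D S (⟦ ticks ⟧ C σ) =
      _ , seq C⇓ D⇓ , pair≤ 1 C D s≤ t≤
    compile-run (if e then C else D) S σ
      with eval e σ in eq
    ... | nil with t , D⇓ , t≤ ← compile-run D S σ =
      _ , ifFalse (trans (eval-shift e) eq) D⇓ ,
      subst (λ c → 1 + c + t ≤ (1 + cost e + (coeff C + coeff D)) * N ^ (deg C ⊔ deg D))
        (sym (cost-shift e)) (pair≤ (1 + cost e) C D {0} z≤n t≤)
    ... | _ ∙ _ with s , C⇓ , s≤ ← compile-run C S σ =
      _ , ifTrue (subst (_≢ nil) (sym (trans (eval-shift e) eq)) λ ()) C⇓ ,
      subst (λ c → 1 + c + s ≤ (1 + cost e + (coeff C + coeff D)) * N ^ (deg C ⊔ deg D))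
        (sym (cost-shift e))
        (≤-trans (+-monoʳ-≤ (1 + cost e) (m≤m+n s 0)) (pair≤ (1 + cost e) C D {t = 0} s≤ z≤n))
    compile-run (for c C) S σ
      with t , W⇓ , t≤ ← while-run C _ (compile-run C) (clockTree c) S σ =
      _ , seq (subst (λ u → ⟨ _ , _ ⟩⇓ (u ∙ S) ∷ _ ∷ _ ∷ _ [ _ ]) (lookup-clock c {S} {σ}) assign)
              (seq W⇓ assign) ,
      ≤-trans bound (for≤ (ticks c) (coeff C) (deg C) (ticks≤N c))
      where
      open ≤-Reasoning
      bound : 1 + 4 + (1 + t + 3) ≤ 12 + ticks c * (11 + coeff C * N ^ deg C)
      bound = begin
        6 + (t + 3)   ≡⟨ cong (6 +_) (+-comm t 3) ⟩
        9 + t         ≤⟨ +-monoʳ-≤ 9 t≤ ⟩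
        12 + ticks c * (11 + coeff C * N ^ deg C) ∎

-- The greedy algorithm as a program

module GreedyProgram where

  open ClockedCode
  open import Data.Fin.Properties using (toℕ<n)
  open import Data.Nat.Base
  open import Data.Nat.Binary.Base as ℕᵇ using (ℕᵇ; 2[1+_]; 1+[2_])
  open import Data.Nat.Binary.Properties using (fromℕ-mono-<)
  open import Data.Nat.Properties

  -- `ℕᵇ` is bijective binary notation, where a smaller number is never longer. The case `inj₂ refl`
  -- is `2x + 1 < 2x + 2`, two numerals of equal length.
  spine-mono-< : ∀ {x y} → x ℕᵇ.< y → spine (encodeℕᵇ x) ≤ spine (encodeℕᵇ y)
  spine-mono-< ℕᵇ.0<even                   = z≤n
  spine-mono-< ℕᵇ.0<odd                    = z≤n
  spine-mono-< (ℕᵇ.even<even x<y)          = s≤s (spine-mono-< x<y)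
  spine-mono-< (ℕᵇ.even<odd x<y)           = s≤s (spine-mono-< x<y)
  spine-mono-< (ℕᵇ.odd<even (inj₁ x<y))    = s≤s (spine-mono-< x<y)
  spine-mono-< (ℕᵇ.odd<even (inj₂ refl))   = ≤-refl
  spine-mono-< (ℕᵇ.odd<odd x<y)            = s≤s (spine-mono-< x<y)

  spine-colour : ∀ {k} (a : Fin k) → spine (encodeColour a) ≤ spine (encodeℕ k)
  spine-colour a = spine-mono-< (fromℕ-mono-< (toℕ<n a))

  spine-encodeVec : ∀ {A : Set} (f : A → Tree) {n} (xs : Vec A n) → spine (encodeVec f xs) ≡ n
  spine-encodeVec f []       = refl
  spine-encodeVec f (x ∷ xs) = cong suc (spine-encodeVec f xs)

  iterate-suc : ∀ {A : Set} (f : A → A) x n → iterate f x (suc n) ≡ f (iterate f x n)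
  iterate-suc f x n =
    trans (sym (iterate-is-fold x f (suc n))) (cong f (iterate-is-fold x f n))

  nonNil : Tree → Bool
  nonNil nil     = false
  nonNil (_ ∙ _) = true

  DataVars : ℕ
  DataVars = 11

  out rows mark cols row point stack hue clash digits₁ digits₂ : Fin DataVars
  out     = # 0
  rows    = # 1
  mark    = # 2
  cols    = # 3
  row     = # 4
  point   = # 5
  stack   = # 6
  hue     = # 7
  clash   = # 8
  digits₁ = # 9
  digits₂ = # 10

  `true : Expr DataVars
  `true = `cons `nil `nil

  -- The head of an empty list is nil, like a false digit, so both the
  -- emptiness of the lists and their heads are compared.
  differ : Expr DataVars → Expr DataVars → Code DataVars
  differ d e = if d then (if e then skip else (clash := `true))
                    else (if e then (clash := `true) else skip)

  compareDigit : Code DataVars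
  compareDigit =
    differ (var digits₁) (var digits₂) ⨾
    differ (`left (var digits₁)) (`left (var digits₂)) ⨾
    digits₁ := `right (var digits₁) ⨾ digits₂ := `right (var digits₂)

  push : Expr DataVars → Code DataVars
  push e = stack := `cons (`cons e (`left (var cols))) (var stack)

  pushFlag : Code DataVars
  pushFlag = if `left (var row) then push `true
             else (if `left (var point) then push `true else push `nil)

  see : Code DataVars
  see =
    if `left (`left (var stack)) then
      (if `right (`left (var stack)) then
        ((if var hue then skip else (hue := `right (`left (var stack)))) ⨾
         digits₁ := `right (var hue) ⨾
         digits₂ := `right (`right (`left (var stack))) ⨾
         for digits compareDigit)
       else skip)
    else skip

  -- The stack that scan builds is in reverse order; paint reverses it back.
  scan : Code DataVars
  scan = pushFlag ⨾ see ⨾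
    row := `right (var row) ⨾ point := `right (var point) ⨾ cols := `right (var cols)

  -- The projection right decodes a Maybe and sends nothing to nil, the code of
  -- the first colour.
  paint : Code DataVars
  paint =
    cols := `cons (`right (`left (var stack))) (var cols) ⨾
    (if `left (`left (var stack)) then
       (if var clash then skip
        else (cols := `cons (`cons `nil (`right (var hue))) (`right (var cols))))
     else skip) ⨾
    out := `cons (`right (`left (var cols))) (var out) ⨾
    stack := `right (var stack)

  visit : Code DataVars
  visit =
    row := `left (var rows) ⨾ rows := `right (var rows) ⨾
    point := var mark ⨾ mark := `cons `nil (var mark) ⨾
    for vertices scan ⨾
    out := `nil ⨾
    for vertices paint ⨾
    point := `nil ⨾ hue := `nil ⨾ clash := `nil

  -- Models the comparison loop with `b` as the flag so far. The program has no early exit, so the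
  -- recursion goes on after a mismatch until both numerals are used up. Numerals in `ℕᵇ` are
  -- unique, so comparing digits decides equality.
  distinct : Bool → ℕᵇ → ℕᵇ → Bool
  distinct b ℕᵇ.zero   ℕᵇ.zero   = b
  distinct b ℕᵇ.zero   2[1+ y ]  = distinct true ℕᵇ.zero y
  distinct b ℕᵇ.zero   1+[2 y ]  = distinct true ℕᵇ.zero y
  distinct b 2[1+ x ]  ℕᵇ.zero   = distinct true x ℕᵇ.zero
  distinct b 2[1+ x ]  2[1+ y ]  = distinct b x y
  distinct b 2[1+ x ]  1+[2 y ]  = distinct true x y
  distinct b 1+[2 x ]  ℕᵇ.zero   = distinct true x ℕᵇ.zero
  distinct b 1+[2 x ]  2[1+ y ]  = distinct true x y
  distinct b 1+[2 x ]  1+[2 y ]  = distinct b x y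

  distinct-refl : ∀ b x → distinct b x x ≡ b
  distinct-refl b ℕᵇ.zero  = refl
  distinct-refl b 2[1+ x ] = distinct-refl b x
  distinct-refl b 1+[2 x ] = distinct-refl b x

  distinct-true : ∀ x y → distinct true x y ≡ true
  distinct-true ℕᵇ.zero  ℕᵇ.zero  = refl
  distinct-true ℕᵇ.zero  2[1+ y ] = distinct-true ℕᵇ.zero y
  distinct-true ℕᵇ.zero  1+[2 y ] = distinct-true ℕᵇ.zero y
  distinct-true 2[1+ x ] ℕᵇ.zero  = distinct-true x ℕᵇ.zero
  distinct-true 2[1+ x ] 2[1+ y ] = distinct-true x y
  distinct-true 2[1+ x ] 1+[2 y ] = distinct-true x y
  distinct-true 1+[2 x ] ℕᵇ.zero  = distinct-true x ℕᵇ.zero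
  distinct-true 1+[2 x ] 2[1+ y ] = distinct-true x y
  distinct-true 1+[2 x ] 1+[2 y ] = distinct-true x y

  -- By `distinct-true` a raised flag stays raised, so a final `false` excludes every mismatch on
  -- the way.
  distinct-false : ∀ {b} x y → distinct b x y ≡ false → b ≡ false × x ≡ y
  distinct-false ℕᵇ.zero  ℕᵇ.zero  eq = eq , refl
  distinct-false ℕᵇ.zero  2[1+ y ] eq with () ← trans (sym (distinct-true ℕᵇ.zero y)) eq
  distinct-false ℕᵇ.zero  1+[2 y ] eq with () ← trans (sym (distinct-true ℕᵇ.zero y)) eq
  distinct-false 2[1+ x ] ℕᵇ.zero  eq with () ← trans (sym (distinct-true x ℕᵇ.zero)) eq
  distinct-false 2[1+ x ] 1+[2 y ] eq with () ← trans (sym (distinct-true x y)) eq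
  distinct-false 1+[2 x ] ℕᵇ.zero  eq with () ← trans (sym (distinct-true x ℕᵇ.zero)) eq
  distinct-false 1+[2 x ] 2[1+ y ] eq with () ← trans (sym (distinct-true x y)) eq
  distinct-false 2[1+ x ] 2[1+ y ] eq with b≡ , refl ← distinct-false x y eq = b≡ , refl
  distinct-false 1+[2 x ] 1+[2 y ] eq with b≡ , refl ← distinct-false x y eq = b≡ , refl

  module _ (ticks : Clock → ℕ) where

    run : Code DataVars → Store DataVars → Store DataVars
    run = ⟦_⟧ ticks

    -- Once both numerals are exhausted, the remaining rounds see two empty lists and change
    -- nothing, so any sufficiently large `L` will do.
    compare-run : ∀ {o rs p cs r q st h} L b x y →
      spine (encodeℕᵇ x) ≤ L → spine (encodeℕᵇ y) ≤ L →
      iterate (run compareDigit)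
        (o ∷ rs ∷ p ∷ cs ∷ r ∷ q ∷ st ∷ h ∷ encodeBool b ∷ encodeℕᵇ x ∷ encodeℕᵇ y ∷ []) L
      ≡ o ∷ rs ∷ p ∷ cs ∷ r ∷ q ∷ st ∷ h ∷ encodeBool (distinct b x y) ∷ nil ∷ nil ∷ []
    compare-run zero    b ℕᵇ.zero  ℕᵇ.zero  _ _ = refl
    compare-run (suc L) b ℕᵇ.zero  ℕᵇ.zero  _ _ = compare-run L b ℕᵇ.zero ℕᵇ.zero z≤n z≤n
    compare-run (suc L) b ℕᵇ.zero  2[1+ y ] _ (s≤s y≤) = compare-run L true ℕᵇ.zero y z≤n y≤
    compare-run (suc L) b ℕᵇ.zero  1+[2 y ] _ (s≤s y≤) = compare-run L true ℕᵇ.zero y z≤n y≤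
    compare-run (suc L) b 2[1+ x ] ℕᵇ.zero  (s≤s x≤) _ = compare-run L true x ℕᵇ.zero x≤ z≤n
    compare-run (suc L) b 1+[2 x ] ℕᵇ.zero  (s≤s x≤) _ = compare-run L true x ℕᵇ.zero x≤ z≤n
    compare-run (suc L) b 2[1+ x ] 2[1+ y ] (s≤s x≤) (s≤s y≤) = compare-run L b x y x≤ y≤
    compare-run (suc L) b 2[1+ x ] 1+[2 y ] (s≤s x≤) (s≤s y≤) = compare-run L true x y x≤ y≤
    compare-run (suc L) b 1+[2 x ] 2[1+ y ] (s≤s x≤) (s≤s y≤) = compare-run L true x y x≤ y≤
    compare-run (suc L) b 1+[2 x ] 1+[2 y ] (s≤s x≤) (s≤s y≤) = compare-run L b x y x≤ y≤

  -- The same algorithm as a function, and agreement of the program with it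

  module Greedy {k : ℕ} (z : Fin k) where

    Partial : ℕ → Set
    Partial n = Vec (Maybe (Fin k)) n

    Survey : Set
    Survey = Maybe (Fin k) × Bool

    code : Fin k → ℕᵇ
    code a = ℕᵇ.fromℕ (toℕ a)

    -- The first colour met becomes the hue and is then compared with itself, as in `see`; this
    -- leaves the flag as it was.
    notice : Bool → Maybe (Fin k) → Survey → Survey
    notice false c        s       = s
    notice true  nothing  s       = s
    notice true  (just b) (h , t) =
      just (fromMaybe b h) , distinct t (code (fromMaybe b h)) (code b)

    survey : ∀ {n} → Vec Bool n → Partial n → Survey → Survey
    survey []       []       s = s
    survey (f ∷ fs) (c ∷ cs) s = survey fs cs (notice f c s)

    repaint : Survey → Bool → Maybe (Fin k) → Maybe (Fin k)
    repaint s           false c = c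
    repaint (h , true)  true  c = c
    repaint (h , false) true  c = just (fromMaybe z h)

    step : ∀ {n} → Vec Bool n → Partial n → Partial n
    step fs cs = zipWith (repaint (survey fs cs (nothing , false))) fs cs

    fill : ∀ {n} → Partial n → Vec (Fin k) n
    fill = Vec.map (fromMaybe z)

    -- A row of the adjacency matrix misses its own vertex; the mark q, a list
    -- that is true only at the position of that vertex, adds it.
    withPoint : ∀ {n} → Vec Bool n → Tree → Vec Bool n
    withPoint []       q = []
    withPoint (f ∷ fs) q = (f ∨ nonNil (left q)) ∷ withPoint fs (right q)

    greedy : ∀ {m n} → Vec (Vec Bool n) m → Tree → Partial n → Partial n
    greedy []       p cs = cs
    greedy (r ∷ rs) p cs = greedy rs (nil ∙ p) (step (withPoint r p) cs)

    pushAll : ∀ {n} → Vec Bool n → Partial n → Tree → Tree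
    pushAll []       []       st = st
    pushAll (f ∷ fs) (c ∷ cs) st =
      pushAll fs cs ((encodeBool f ∙ encodeMaybe encodeColour c) ∙ st)

    encodeHue : Maybe (Fin k) → Tree
    encodeHue = encodeMaybe encodeColour

    encodePartial : ∀ {n} → Partial n → Tree
    encodePartial = encodeVec encodeHue

    encodeRow : ∀ {n} → Vec Bool n → Tree
    encodeRow = encodeVec encodeBool

    module Correct (z≡nil : encodeColour z ≡ nil) (ticks : Clock → ℕ)
                   (digits≡ : ticks digits ≡ spine (encodeℕ k)) where

      pushFlag-run : ∀ {o rs p st h b} f r c cs q →
        run ticks pushFlag
          (o ∷ rs ∷ p ∷ (c ∙ cs) ∷ (encodeBool f ∙ r) ∷ q ∷ st ∷ h ∷ b ∷ nil ∷ nil ∷ [])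
        ≡ o ∷ rs ∷ p ∷ (c ∙ cs) ∷ (encodeBool f ∙ r) ∷ q ∷
          ((encodeBool (f ∨ nonNil (left q)) ∙ c) ∙ st) ∷ h ∷ b ∷ nil ∷ nil ∷ []
      pushFlag-run true  r c cs q = refl
      pushFlag-run false r c cs q with left q
      ... | nil   = refl
      ... | _ ∙ _ = refl

      see-run : ∀ {o rs p cs r q st} f c h t →
        let h′ , t′ = notice f c (h , t) in
        run ticks see
          (o ∷ rs ∷ p ∷ cs ∷ r ∷ q ∷ ((encodeBool f ∙ encodeHue c) ∙ st) ∷
           encodeHue h ∷ encodeBool t ∷ nil ∷ nil ∷ [])
        ≡ o ∷ rs ∷ p ∷ cs ∷ r ∷ q ∷ ((encodeBool f ∙ encodeHue c) ∙ st) ∷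
          encodeHue h′ ∷ encodeBool t′ ∷ nil ∷ nil ∷ []
      see-run false c        h        t = refl
      see-run true  nothing  h        t = refl
      see-run true  (just b) nothing  t rewrite digits≡ =
        compare-run ticks _ t (code b) (code b) (spine-colour b) (spine-colour b)
      see-run true  (just b) (just a) t rewrite digits≡ =
        compare-run ticks _ t (code a) (code b) (spine-colour a) (spine-colour b)

      scan-run : ∀ {o rs p n} (fs : Vec Bool n) (cs : Partial n) q st h t →
        let h′ , t′ = survey (withPoint fs q) cs (h , t) in
        iterate (run ticks scan)
          (o ∷ rs ∷ p ∷ encodePartial cs ∷ encodeRow fs ∷ q ∷ st ∷
           encodeHue h ∷ encodeBool t ∷ nil ∷ nil ∷ []) n
        ≡ o ∷ rs ∷ p ∷ nil ∷ nil ∷ iterate right q n ∷ pushAll (withPoint fs q) cs st ∷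
          encodeHue h′ ∷ encodeBool t′ ∷ nil ∷ nil ∷ []
      scan-run []       []       q st h t = refl
      scan-run {o} {rs} {p} {suc n} (f ∷ fs) (c ∷ cs) q st h t
        rewrite pushFlag-run {o} {rs} {p} {st} {encodeHue h} {encodeBool t}
                  f (encodeRow fs) (encodeHue c) (encodePartial cs) q
              | see-run {o} {rs} {p} {encodePartial (c ∷ cs)} {encodeRow (f ∷ fs)} {q} {st}
                  (f ∨ nonNil (left q)) c h t
        = scan-run fs cs (right q) _ _ _

      encode-default : ∀ c → right (encodeHue c) ≡ encodeColour (fromMaybe z c)
      encode-default nothing  = sym z≡nil
      encode-default (just a) = refl

      paint-step : ∀ {rs p q st n} (o : Vec (Fin k) n) (cs : Partial n) f c h t →
        let c′ = repaint (h , t) f c in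
        run ticks paint
          (encodeColouring o ∷ rs ∷ p ∷ encodePartial cs ∷ nil ∷ q ∷
           ((encodeBool f ∙ encodeHue c) ∙ st) ∷ encodeHue h ∷ encodeBool t ∷ nil ∷ nil ∷ [])
        ≡ encodeColouring (fromMaybe z c′ ∷ o) ∷ rs ∷ p ∷ encodePartial (c′ ∷ cs) ∷ nil ∷ q ∷
          st ∷ encodeHue h ∷ encodeBool t ∷ nil ∷ nil ∷ []
      paint-step o cs false c h t     rewrite encode-default c = refl
      paint-step o cs true  c h true  rewrite encode-default c = refl
      paint-step o cs true  c h false rewrite encode-default h = refl

      -- `pushAll` leaves the first vertex deepest, so it is painted in the last round. Hence
      -- `iterate-suc` splits off the last round instead of the first.
      paint-run : ∀ {rs p q n} (fs : Vec Bool n) (cs : Partial n) st h t →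
        let cs′ = zipWith (repaint (h , t)) fs cs in
        iterate (run ticks paint)
          (nil ∷ rs ∷ p ∷ nil ∷ nil ∷ q ∷ pushAll fs cs st ∷
           encodeHue h ∷ encodeBool t ∷ nil ∷ nil ∷ []) n
        ≡ encodeColouring (fill cs′) ∷ rs ∷ p ∷ encodePartial cs′ ∷ nil ∷ q ∷ st ∷
          encodeHue h ∷ encodeBool t ∷ nil ∷ nil ∷ []
      paint-run []       []       st h t = refl
      paint-run {n = suc n} (f ∷ fs) (c ∷ cs) st h t =
        trans (iterate-suc (run ticks paint) _ n)
       (trans (cong (run ticks paint) (paint-run fs cs _ h t))
              (paint-step (fill cs′) cs′ f c h t))
        where
        cs′ : Partial n
        cs′ = zipWith (repaint (h , t)) fs cs

      visit-run : ∀ {o rs n} (p : Tree) (r : Vec Bool n) (cs : Partial n) → ticks vertices ≡ n →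
        let cs′ = step (withPoint r p) cs in
        run ticks visit
          (o ∷ (encodeRow r ∙ rs) ∷ p ∷ encodePartial cs ∷
           nil ∷ nil ∷ nil ∷ nil ∷ nil ∷ nil ∷ nil ∷ [])
        ≡ encodeColouring (fill cs′) ∷ rs ∷ (nil ∙ p) ∷ encodePartial cs′ ∷
          nil ∷ nil ∷ nil ∷ nil ∷ nil ∷ nil ∷ nil ∷ []
      visit-run {o} {rs} {n} p r cs refl
        rewrite scan-run {o} {rs} {nil ∙ p} r cs p nil nothing false
        = cong (λ σ → run ticks (point := `nil ⨾ hue := `nil ⨾ clash := `nil) σ)
            (paint-run (withPoint r p) cs nil _ _)

      -- Each visit rebuilds `out` from scratch. Only when no visit remains must `o` already be
      -- right, which matters for the empty graph.
      greedy-run : ∀ {o m n} (p : Tree) (rs : Vec (Vec Bool n) m) (cs : Partial n) →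
        ticks vertices ≡ n → (m ≡ 0 → o ≡ encodeColouring (fill cs)) →
        ∃[ p′ ] iterate (run ticks visit)
          (o ∷ encodeVec encodeRow rs ∷ p ∷ encodePartial cs ∷
           nil ∷ nil ∷ nil ∷ nil ∷ nil ∷ nil ∷ nil ∷ []) m
        ≡ encodeColouring (fill (greedy rs p cs)) ∷ nil ∷ p′ ∷ encodePartial (greedy rs p cs) ∷
          nil ∷ nil ∷ nil ∷ nil ∷ nil ∷ nil ∷ nil ∷ []
      greedy-run p []       cs n≡ o≡ rewrite o≡ refl = p , refl
      greedy-run {o} p (r ∷ rs) cs n≡ o≡
        rewrite visit-run {o} {encodeVec encodeRow rs} p r cs n≡
        = greedy-run (nil ∙ p) rs (step (withPoint r p) cs) n≡ (λ _ → refl)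

  -- The complete program and its running time

  firstColour : ∀ k → {{NonZero k}} → Fin k
  firstColour (suc k) = zero

  encode-firstColour : ∀ k → {{_ : NonZero k}} → encodeColour (firstColour k) ≡ nil
  encode-firstColour (suc k) = refl

  marker : ℕ → Tree
  marker zero    = (nil ∙ nil) ∙ nil
  marker (suc j) = nil ∙ marker j

  loadData : Cmd (3 + DataVars)
  loadData =
    # 4 := `left (var zero) ⨾
    # 5 := `cons (`cons `nil `nil) `nil ⨾
    # 6 := `right (`right (var zero))

  loadClocks : Cmd (3 + DataVars)
  loadClocks = # 1 := `right (`right (var zero)) ⨾ # 2 := `left (`right (var zero))

  -- The input stays in variable zero as the bottom of the clock stack. Compiled code restores the
  -- stack, so the last assignment merely replaces the input by `out`, which is variable 3 after the
  -- shift.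
  greedyProgram : Program
  greedyProgram = program (2 + DataVars)
    (loadClocks ⨾ loadData ⨾ compile (for vertices visit) ⨾ zero := var (# 3))

  module Output (I : MHV) where
    open MHV I

    default : Fin k
    default = firstColour k

    open Greedy default public

    adjacency : Vec (Vec Bool n) n
    adjacency = tabulate λ v → tabulate (adj v)

    final : Partial n
    final = greedy adjacency (marker 0) precolour

    output : Colouring
    output = fill final

  greedyProgram-run : ∀ I → ∃[ t ]
    (greedyProgram on encodeMHV I yields encodeColouring (Output.output I) within t ×
     t ≤ (29 + coeff (for vertices visit)) * size (encodeMHV I) ^ deg (for vertices visit))
  greedyProgram-run I =
    _ , (_ , seq (seq assign assign) (seq (seq assign (seq assign assign)) (seq main assign)) ,
         final≡) , bound
    where
    open MHV I
    open Output I

    input inputClock : Tree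
    input      = encodeMHV I
    inputClock = encodePartial precolour

    N : ℕ
    N = size input

    d : ℕ
    d = deg (for vertices visit)

    vertices≤N : spine inputClock ≤ N
    vertices≤N = ≤-trans (spine≤size inputClock)
      (m≤n⇒m≤1+n (≤-trans (m≤n⇒m≤1+n (m≤n+m _ (size (encodeℕ k)))) (m≤n+m _ _)))

    digits≤N : spine (encodeℕ k) ≤ N
    digits≤N = ≤-trans (spine≤size (encodeℕ k))
      (m≤n⇒m≤1+n (≤-trans (m≤n⇒m≤1+n (m≤m+n _ _)) (m≤n+m _ _)))

    σ₀ : Store DataVars
    σ₀ = nil ∷ encodeVec encodeRow adjacency ∷ marker 0 ∷ inputClock ∷
         nil ∷ nil ∷ nil ∷ nil ∷ nil ∷ nil ∷ nil ∷ []

    instance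
      N≢0 : NonZero N
      N≢0 = _

    clocks : Clock → ℕ
    clocks = ticks {DataVars} inputClock (encodeℕ k) N vertices≤N digits≤N

    σ₁ : Store DataVars
    σ₁ = ⟦_⟧ clocks (for vertices visit) σ₀

    loop-run : Runs inputClock (encodeℕ k) N vertices≤N digits≤N
      (compile (for vertices visit)) input input σ₀ σ₁ (coeff (for vertices visit) * N ^ d)
    loop-run = compile-run inputClock (encodeℕ k) N vertices≤N digits≤N
                 (for vertices visit) input σ₀

    main : ⟨ compile (for vertices visit) , input ∷ inputClock ∷ encodeℕ k ∷ σ₀ ⟩⇓
           input ∷ inputClock ∷ encodeℕ k ∷ σ₁ [ proj₁ loop-run ]
    main = proj₁ (proj₂ loop-run)

    n≡ : clocks vertices ≡ n
    n≡ = spine-encodeVec encodeHue precolour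

    empty-output : ∀ {m} (cs : Partial m) → m ≡ 0 → nil ≡ encodeColouring (fill cs)
    empty-output [] _ = refl

    final≡ : lookup σ₁ zero ≡ encodeColouring output
    final≡ = cong (λ σ → lookup σ zero) (trans (cong (iterate (run clocks visit) σ₀) n≡)
      (proj₂ (Correct.greedy-run (encode-firstColour k) clocks refl (marker 0) adjacency precolour
               n≡ (empty-output precolour))))

    -- The 27 steps are for loading clocks and data and for sequencing; the 2 copy the output.
    bound : 27 + (proj₁ loop-run + 2) ≤ (29 + coeff (for vertices visit)) * N ^ d
    bound = begin
      27 + (proj₁ loop-run + 2)
        ≡⟨ cong (27 +_) (+-comm (proj₁ loop-run) 2) ⟩
      29 + proj₁ loop-run
        ≤⟨ +-mono-≤ (m≤m*n 29 (N ^ d) {{m^n≢0 N d}}) (proj₂ (proj₂ loop-run)) ⟩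
      29 * N ^ d + coeff (for vertices visit) * N ^ d
        ≡⟨ *-distribʳ-+ (N ^ d) 29 (coeff (for vertices visit)) ⟨
      (29 + coeff (for vertices visit)) * N ^ d ∎
      where open ≤-Reasoning

  greedyProgram-polynomial : PolynomialTime encodeMHV greedyProgram
  greedyProgram-polynomial =
    29 + coeff (for vertices visit) , deg (for vertices visit) , λ I →
    let t , runs , t≤ = greedyProgram-run I in _ , t , runs , t≤

  greedyProgram-outputs : ∀ I →
    Outputs greedyProgram (encodeMHV I) (encodeColouring (Output.output I))
  greedyProgram-outputs I = let t , runs , _ = greedyProgram-run I in t , runs

-- The approximation guarantee

module GreedyBound where

  open GreedyProgram
  open import Data.Bool.Properties using (T?; ∨-zeroʳ; T-≡)
  open import Data.Fin.Properties using (toℕ-injective; _≟_)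
  open import Data.List.Base as List using (List; []; _∷_; length; filter; allFin; concatMap)
  open import Data.List.Extrema.Nat using (xs≤max)
  open import Data.List.Membership.Propositional using (_∈_)
  open import Data.List.Membership.Propositional.Properties
  open import Data.List.Properties using (length-++; filter-notAll)
  import Data.List.Relation.Unary.All as All
  open import Data.List.Relation.Unary.AllPairs using ([]; _∷_)
  open import Data.List.Relation.Unary.Any as Any using (here; there)
  open import Data.List.Relation.Unary.Unique.Propositional using (Unique)
  open import Data.List.Relation.Unary.Unique.Propositional.Properties using (allFin⁺; filter⁺)
  open import Data.Nat.Base
  open import Data.Nat.Binary.Properties using (fromℕ-injective)
  open import Data.Nat.Properties hiding (_≟_)
  open import Data.Vec.Properties using (lookup-map; lookup-zipWith; lookup∘tabulate)
  open import Function.Bundles using (Equivalence)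
  open import Relation.Nullary using (yes; no; ¬?; contradiction)

  -- Deleting all copies of the head of `vs` from `ws` shortens `ws` strictly and keeps the rest of
  -- `vs` inside. Here `ws` may repeat entries, as a union of overlapping balls does.
  length-⊆ : ∀ {n} {vs ws : List (Fin n)} → Unique vs → (∀ {v} → v ∈ vs → v ∈ ws) →
             length vs ≤ length ws
  length-⊆ []        _  = z≤n
  length-⊆ {vs = v ∷ vs} {ws} (v∉vs ∷ vs!) vs⊆ws =
    ≤-<-trans (length-⊆ vs! vs⊆rest) (filter-notAll (λ w → ¬? (v ≟ w)) ws
      (Any.map (λ v≡w v≢w → v≢w v≡w) (vs⊆ws (here refl))))
    where
    vs⊆rest : ∀ {w} → w ∈ vs → w ∈ filter (λ w → ¬? (v ≟ w)) ws
    vs⊆rest w∈ = ∈-filter⁺ (λ w → ¬? (v ≟ w)) (vs⊆ws (there w∈)) (All.lookup v∉vs w∈)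

  length-concatMap : ∀ {A B : Set} (f : A → List B) b → (∀ a → length (f a) ≤ b) →
                     ∀ as → length (concatMap f as) ≤ length as * b
  length-concatMap f b f≤ []       = z≤n
  length-concatMap f b f≤ (a ∷ as) rewrite length-++ (f a) {concatMap f as} =
    +-mono-≤ (f≤ a) (length-concatMap f b f≤ as)

  ∈-concatMap : ∀ {A B : Set} (f : A → List B) {a b as} → a ∈ as → b ∈ f a → b ∈ concatMap f as
  ∈-concatMap f a∈ b∈ = ∈-concatMap⁺ f (Any.map (λ { refl → b∈ }) a∈)

  marker-self : ∀ j → nonNil (left (iterate right (marker j) j)) ≡ true
  marker-self zero    = refl
  marker-self (suc j) = marker-self j

  iterate-right-nil : ∀ i → iterate right nil i ≡ nil
  iterate-right-nil zero    = refl
  iterate-right-nil (suc i) = iterate-right-nil i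

  marker-other : ∀ j i → nonNil (left (iterate right (marker j) i)) ≡ true → i ≡ j
  marker-other zero    zero    eq = refl
  marker-other zero    (suc i) eq rewrite iterate-right-nil i with () ← eq
  marker-other (suc j) (suc i) eq = cong suc (marker-other j i eq)

  -- What one greedy step does to a partial colouring

  module StepProperties {k : ℕ} (z : Fin k) where
    open Greedy z

    infix 4 _⊑_
    record _⊑_ {n} (cs cs′ : Partial n) : Set where
      constructor extending
      field keeps : ∀ u b → lookup cs u ≡ just b → lookup cs′ u ≡ just b
    open _⊑_ public

    ⊑-refl : ∀ {n} {cs : Partial n} → cs ⊑ cs
    ⊑-refl = extending λ _ _ eq → eq

    ⊑-trans : ∀ {n} {cs cs′ cs″ : Partial n} → cs ⊑ cs′ → cs′ ⊑ cs″ → cs ⊑ cs″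
    ⊑-trans p q = extending λ u b → keeps q u b ∘ keeps p u b

    Mono : ∀ {n} → Vec Bool n → Partial n → Set
    Mono fs cs = ∃[ a ] ∀ u → lookup fs u ≡ true → lookup cs u ≡ just a

    Mono-⊑ : ∀ {n} {fs : Vec Bool n} {cs cs′} → cs ⊑ cs′ → Mono fs cs → Mono fs cs′
    Mono-⊑ cs⊑ (a , mono) = a , λ u fu → keeps cs⊑ u a (mono u fu)

    code-injective : ∀ {a b} → code a ≡ code b → a ≡ b
    code-injective = toℕ-injective ∘ fromℕ-injective

    lookup-withPoint : ∀ {n} (fs : Vec Bool n) q u →
      lookup (withPoint fs q) u ≡ lookup fs u ∨ nonNil (left (iterate right q (toℕ u)))
    lookup-withPoint (f ∷ fs) q zero    = refl
    lookup-withPoint (f ∷ fs) q (suc u) = lookup-withPoint fs (right q) u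

    -- Reasons backwards from the lowered flag: `distinct-false` shows that it was down before and
    -- that the new colour equals the hue.
    notice-agrees : ∀ f c {h t h′} → notice f c (h , t) ≡ (h′ , false) →
      t ≡ false × (∀ a → h ≡ just a → h′ ≡ just a) × (f ≡ true → ∀ b → c ≡ just b → h′ ≡ just b)
    notice-agrees false c        refl = refl , (λ _ e → e) , λ ()
    notice-agrees true  nothing  refl = refl , (λ _ e → e) , λ _ _ ()
    notice-agrees true  (just b) {h} {t} eq
      with distinct t (code (fromMaybe b h)) (code b) in d | eq
    ... | false | refl with t≡ , e ← distinct-false (code (fromMaybe b h)) (code b) d
                       with a≡b ← code-injective {fromMaybe b h} {b} e =
      t≡ , (λ { a refl → refl }) , λ { _ _ refl → cong just a≡b }

    survey-agrees : ∀ {n} (fs : Vec Bool n) cs {h t h′} → survey fs cs (h , t) ≡ (h′ , false) →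
      t ≡ false × (∀ a → h ≡ just a → h′ ≡ just a) ×
      (∀ u b → lookup fs u ≡ true → lookup cs u ≡ just b → h′ ≡ just b)
    survey-agrees []       []       refl = refl , (λ _ e → e) , λ ()
    survey-agrees (f ∷ fs) (c ∷ cs) {h} {t} eq
      with h₁ , t₁ ← notice f c (h , t) in first
      with refl , later , rest ← survey-agrees fs cs eq
      with t≡ , kept , head ← notice-agrees f c first =
      t≡ , (λ a → later a ∘ kept a) ,
      λ { zero b fu cu → later b (head fu b cu) ; (suc u) b fu cu → rest u b fu cu }

    -- The condition on `h` holds as long as every colour met is `d`, and meeting `d` again never
    -- raises the flag. The colour `d` is arbitrary because it will be the optimal colour of the
    -- vertex, which the algorithm does not know.
    survey-clash : ∀ {n} (fs : Vec Bool n) cs {h} d → h ≡ nothing ⊎ h ≡ just d →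
      proj₂ (survey fs cs (h , false)) ≡ true →
      ∃[ u ] ∃[ b ] (lookup fs u ≡ true × lookup cs u ≡ just b × b ≢ d)
    survey-clash []           []       d h≡ ()
    survey-clash (false ∷ fs) (c ∷ cs) d h≡ eq
      with u , b , fu , cu , b≢d ← survey-clash fs cs d h≡ eq = suc u , b , fu , cu , b≢d
    survey-clash (true ∷ fs) (nothing ∷ cs) d h≡ eq
      with u , b , fu , cu , b≢d ← survey-clash fs cs d h≡ eq = suc u , b , fu , cu , b≢d
    survey-clash (true ∷ fs) (just b ∷ cs) d h≡ eq with b ≟ d
    ... | no b≢d = zero , b , refl , refl , b≢d
    survey-clash (true ∷ fs) (just b ∷ cs) d (inj₁ refl) eq | yes refl
      rewrite distinct-refl false (code b)
      with u , b , fu , cu , b≢d ← survey-clash fs cs d (inj₂ refl) eq = suc u , b , fu , cu , b≢d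
    survey-clash (true ∷ fs) (just b ∷ cs) d (inj₂ refl) eq | yes refl
      rewrite distinct-refl false (code b)
      with u , b , fu , cu , b≢d ← survey-clash fs cs d (inj₂ refl) eq = suc u , b , fu , cu , b≢d

    data Outcome {n} (fs : Vec Bool n) (cs cs′ : Partial n) : Set where
      painted : cs ⊑ cs′ → Mono fs cs′ →
                (∀ u b → lookup cs′ u ≡ just b → lookup fs u ≡ true ⊎ lookup cs u ≡ just b) →
                Outcome fs cs cs′
      blocked : (∀ u → lookup cs′ u ≡ lookup cs u) →
                (∀ d → ∃[ u ] ∃[ b ] (lookup fs u ≡ true × lookup cs u ≡ just b × b ≢ d)) →
                Outcome fs cs cs′

    repaint-clash : ∀ h f c → repaint (h , true) f c ≡ c
    repaint-clash h false c = refl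
    repaint-clash h true  c = refl

    step-outcome : ∀ {n} (fs : Vec Bool n) cs → Outcome fs cs (step fs cs)
    step-outcome fs cs with survey fs cs (nothing , false) in eq
    ... | h , true = blocked
      (λ u → trans (lookup-zipWith _ u fs cs) (repaint-clash h (lookup fs u) (lookup cs u)))
      (λ d → survey-clash fs cs d (inj₁ refl) (cong proj₂ eq))
    ... | h , false = painted (extending extends) (fromMaybe z h , mono) origin
      where
      agrees : ∀ u b → lookup fs u ≡ true → lookup cs u ≡ just b → h ≡ just b
      agrees = proj₂ (proj₂ (survey-agrees fs cs eq))

      at : ∀ u → lookup (zipWith (repaint (h , false)) fs cs) u
               ≡ repaint (h , false) (lookup fs u) (lookup cs u)
      at u = lookup-zipWith _ u fs cs

      mono : ∀ u → lookup fs u ≡ true →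
             lookup (zipWith (repaint (h , false)) fs cs) u ≡ just (fromMaybe z h)
      mono u fu = trans (at u) (cong (λ f → repaint (h , false) f (lookup cs u)) fu)

      extends : ∀ u b → lookup cs u ≡ just b →
                lookup (zipWith (repaint (h , false)) fs cs) u ≡ just b
      extends u b cu with lookup fs u in fu
      -- `repaint` does write to this coloured cell, but without a clash it writes the colour
      -- already there.
      ... | true  = trans (mono u fu) (cong (just ∘ fromMaybe z) (agrees u b fu cu))
      ... | false = trans (at u) (trans (cong (λ f → repaint (h , false) f (lookup cs u)) fu) cu)

      origin : ∀ u b → lookup (zipWith (repaint (h , false)) fs cs) u ≡ just b →
               lookup fs u ≡ true ⊎ lookup cs u ≡ just b
      origin u b eq′ with lookup fs u in fu
      ... | true  = inj₁ refl
      ... | false = inj₂ (trans (sym (trans (at u)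
                      (cong (λ f → repaint (h , false) f (lookup cs u)) fu))) eq′)

  -- Charging optimal happy vertices to happy vertices of the output

  module Approximation (I : MHV) where
    open MHV I
    open Output I
    open StepProperties default

    nbhd : Fin n → Vec Bool n
    nbhd v = withPoint (tabulate (adj v)) (marker (toℕ v))

    Near : Fin n → Fin n → Set
    Near v u = lookup (nbhd v) u ≡ true

    lookup-nbhd : ∀ v u →
      lookup (nbhd v) u ≡ adj v u ∨ nonNil (left (iterate right (marker (toℕ v)) (toℕ u)))
    lookup-nbhd v u = trans (lookup-withPoint (tabulate (adj v)) (marker (toℕ v)) u)
                            (cong (_∨ _) (lookup∘tabulate (adj v) u))

    near-self : ∀ v → Near v v
    near-self v = trans (lookup-nbhd v v)
      (trans (cong (adj v v ∨_) (marker-self (toℕ v))) (∨-zeroʳ (adj v v)))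

    near-adj : ∀ {v u} → T (adj v u) → Near v u
    near-adj {v} {u} vu = trans (lookup-nbhd v u)
      (cong (_∨ nonNil (left (iterate right (marker (toℕ v)) (toℕ u)))) (Equivalence.to T-≡ vu))

    near⁻ : ∀ {v u} → Near v u → u ≡ v ⊎ T (adj v u)
    near⁻ {v} {u} near with adj v u | lookup-nbhd v u
    ... | true  | _  = inj₂ _
    ... | false | eq = inj₁ (toℕ-injective (marker-other (toℕ v) (toℕ u) (trans (sym eq) near)))

    -- Speaks of one-coloured neighbourhoods instead of the history of painting: this property
    -- passes to extensions, and in `final` it makes `s` happy.
    Covers : Partial n → Fin n → Set
    Covers cs u = ∃[ s ] (Near s u × Mono (nbhd s) cs)

    Covers-⊑ : ∀ {cs cs′ u} → cs ⊑ cs′ → Covers cs u → Covers cs′ u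
    Covers-⊑ cs⊑ (s , su , mono) = s , su , Mono-⊑ {fs = nbhd s} cs⊑ mono

    record Invariant (cs : Partial n) : Set where
      field
        extends : precolour ⊑ cs
        origin  : ∀ u b → lookup cs u ≡ just b → lookup precolour u ≡ just b ⊎ Covers cs u

    Touched : Partial n → Fin n → Set
    Touched cs v = ∃[ u ] (Near v u × Covers cs u)

    Touched-⊑ : ∀ {cs cs′ v} → cs ⊑ cs′ → Touched cs v → Touched cs′ v
    Touched-⊑ cs⊑ (u , vu , cov) = u , vu , Covers-⊑ cs⊑ cov

    module _ (c° : Colouring) (c°-extends : Extends c°) where

      happy-near : ∀ {v u} → Happy c° v → Near v u → lookup c° u ≡ lookup c° v
      happy-near happy vu with near⁻ vu
      ... | inj₁ refl = refl
      ... | inj₂ e    = happy _ e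

      step-invariant : ∀ v {cs} → Invariant cs → let cs′ = step (nbhd v) cs in
        Invariant cs′ × cs ⊑ cs′ × (Happy c° v → Touched cs′ v)
      step-invariant v {cs} inv with step (nbhd v) cs | step-outcome (nbhd v) cs
      ... | cs′ | painted cs⊑ mono origin′ =
        record { extends = ⊑-trans (Invariant.extends inv) cs⊑ ; origin = origin } ,
        cs⊑ , λ _ → v , near-self v , v , near-self v , mono
        where
        origin : ∀ u b → lookup cs′ u ≡ just b → lookup precolour u ≡ just b ⊎ Covers cs′ u
        origin u b eq with origin′ u b eq
        ... | inj₁ vu = inj₂ (v , vu , mono)
        ... | inj₂ cu with Invariant.origin inv u b cu
        ... | inj₁ pu  = inj₁ pu
        ... | inj₂ cov = inj₂ (Covers-⊑ cs⊑ cov)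
      ... | cs′ | blocked same clash =
        record { extends = ⊑-trans (Invariant.extends inv) cs⊑ ; origin = origin } ,
        cs⊑ , touched
        where
        cs⊑ : cs ⊑ cs′
        cs⊑ = extending λ u b → trans (same u)

        origin : ∀ u b → lookup cs′ u ≡ just b → lookup precolour u ≡ just b ⊎ Covers cs′ u
        origin u b eq with Invariant.origin inv u b (trans (sym (same u)) eq)
        ... | inj₁ pu  = inj₁ pu
        ... | inj₂ cov = inj₂ (Covers-⊑ cs⊑ cov)

        touched : Happy c° v → Touched cs′ v
        -- If the deviating colour at `u` were prescribed, `c°` would have it at `u` too, and `v`
        -- would not be happy under `c°`.
        touched happy with u , b , vu , cu , b≢ ← clash (lookup c° v)
          with Invariant.origin inv u b cu
        ... | inj₁ pu  = contradiction (trans (sym (c°-extends u b pu)) (happy-near happy vu)) b≢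
        ... | inj₂ cov = u , vu , Covers-⊑ cs⊑ cov

      -- Generalised to a final segment of the vertices, enumerated by `g`, for the recursion over
      -- rows; the equation keeps the marker on the vertex whose row is being processed.
      greedy-invariant : ∀ {m} (g : Fin m → Fin n) j {cs} → (∀ i → j + toℕ i ≡ toℕ (g i)) →
        Invariant cs → let cs′ = greedy (tabulate λ i → tabulate (adj (g i))) (marker j) cs in
        Invariant cs′ × cs ⊑ cs′ × (∀ i → Happy c° (g i) → Touched cs′ (g i))
      greedy-invariant {zero}  g j g≡ inv = inv , ⊑-refl , λ ()
      greedy-invariant {suc m} g j {cs} g≡ inv
        -- Identifies `j` with `toℕ (g zero)`, so that the marked row is literally `nbhd (g zero)`.
        with refl ← trans (sym (g≡ zero)) (+-identityʳ j)
        with inv₁ , cs⊑ , now ← step-invariant (g zero) inv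
        with inv₂ , cs⊑′ , later ← greedy-invariant (g ∘ suc) (suc (toℕ (g zero)))
               {step (nbhd (g zero)) cs} (λ i → trans (sym (+-suc _ (toℕ i))) (g≡ (suc i))) inv₁
        = inv₂ , ⊑-trans cs⊑ cs⊑′ ,
          λ { zero happy → Touched-⊑ cs⊑′ (now happy) ; (suc i) → later i }

      final-invariant : Invariant final × precolour ⊑ final × (∀ v → Happy c° v → Touched final v)
      final-invariant = greedy-invariant (λ v → v) 0 (λ _ → refl)
        record { extends = ⊑-refl ; origin = λ _ _ → inj₁ }

    lookup-output : ∀ {u a} → lookup final u ≡ just a → lookup output u ≡ a
    lookup-output {u} eq = trans (lookup-map u (fromMaybe default) final)
                                 (cong (fromMaybe default) eq)

    mono⇒happy : ∀ {s} → Mono (nbhd s) final → Happy output s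
    mono⇒happy {s} (a , mono) u su =
      trans (lookup-output (mono u (near-adj su))) (sym (lookup-output (mono s (near-self s))))

    nbrs : Fin n → List (Fin n)
    nbrs v = v ∷ filter (λ u → T? (adj v u)) (allFin n)

    near⇒∈nbrs : ∀ {v u} → Near v u → u ∈ nbrs v
    near⇒∈nbrs vu with near⁻ vu
    ... | inj₁ refl = here refl
    ... | inj₂ e    = there (∈-filter⁺ _ (∈-allFin _) e)

    near-sym : ∀ {v u} → Near v u → Near u v
    near-sym {v} {u} vu with near⁻ vu
    ... | inj₁ refl = near-self v
    ... | inj₂ e    = near-adj (subst T (symm v u) e)

    length-nbrs : ∀ v → length (nbrs v) ≤ suc maxDegree
    length-nbrs v = s≤s (All.lookup (xs≤max 0 (List.map degree (allFin n)))
                                    (∈-map⁺ degree (∈-allFin v)))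

    ball : Fin n → List (Fin n)
    ball s = concatMap nbrs (nbrs s)

    length-ball : ∀ s → length (ball s) ≤ suc maxDegree * suc maxDegree
    length-ball s = ≤-trans (length-concatMap nbrs (suc maxDegree) length-nbrs (nbrs s))
                            (*-monoˡ-≤ (suc maxDegree) (length-nbrs s))

    -- `final-invariant` is relative to a reference extension; the optimal one is at hand.
    output-extends : Extends output
    output-extends v a eq =
      lookup-output (keeps (proj₁ (proj₂ (final-invariant c° c°-extends))) v a eq)
      where
      c° : Colouring
      c° = proj₁ (opt-attained I)
      c°-extends : Extends c°
      c°-extends = proj₁ (proj₂ (opt-attained I))

    happyCount≤ : ∀ c° → Extends c° →
                  happyCount c° ≤ happyCount output * (suc maxDegree * suc maxDegree)
    happyCount≤ c° c°-extends = begin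
      happyCount c°
        ≤⟨ length-⊆ (filter⁺ (happy? c°) (allFin⁺ n)) covered ⟩
      length (concatMap ball (filter (happy? output) (allFin n)))
        ≤⟨ length-concatMap ball _ length-ball (filter (happy? output) (allFin n)) ⟩
      happyCount output * (suc maxDegree * suc maxDegree) ∎
      where
      open ≤-Reasoning
      covered : ∀ {v} → v ∈ filter (happy? c°) (allFin n) →
                v ∈ concatMap ball (filter (happy? output) (allFin n))
      covered {v} v∈
        with _ , happy ← ∈-filter⁻ (happy? c°) {xs = allFin n} v∈
        with u , vu , s , su , mono ← proj₂ (proj₂ (final-invariant c° c°-extends)) v happy =
        ∈-concatMap ball (∈-filter⁺ (happy? output) (∈-allFin s) (mono⇒happy mono))
          -- The path runs outwards from `s` through `u` to `v`, so its second edge has to be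
          -- reversed.
          (∈-concatMap nbrs (near⇒∈nbrs su) (near⇒∈nbrs (near-sym vu)))

    opt≤ : opt I ≤ happyCount output * (suc maxDegree * suc maxDegree)
    opt≤ = subst (_≤ happyCount output * (suc maxDegree * suc maxDegree))
      (proj₂ (proj₂ (opt-attained I)))
      (happyCount≤ (proj₁ (opt-attained I)) (proj₁ (proj₂ (opt-attained I))))

-- Passage to rational numbers

module Arithmetic where

  open import Data.Integer.Base as ℤ using (+_)
  import Data.Integer.Properties as ℤ
  open import Data.Nat.Base as ℕ using (ℕ; suc; NonZero; _^_)
  import Data.Nat.Properties as ℕ
  open import Data.Rational.Base using (ℚ; _≤_; _*_; _/_; toℚᵘ)
  open import Data.Rational.Properties using (toℚᵘ-cancel-≤; toℚᵘ-homo-*; toℚᵘ-fromℚᵘ)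
  open import Data.Rational.Unnormalised.Base as ℚᵘ using (mkℚᵘ; *≤*)
  import Data.Rational.Unnormalised.Properties as ℚᵘ

  -- Among unnormalised fractions, where nothing is cancelled, the inequality is the hypothesis
  -- after cross-multiplication.
  quarter-bound : ∀ o h m {{_ : NonZero m}} → o ℕ.≤ h ℕ.* (4 ℕ.* m) →
                  (+ 1 / 4) * (+ 1 / m) * (+ o / 1) ≤ + h / 1
  quarter-bound o h (suc m) o≤ = toℚᵘ-cancel-≤ (begin
    toℚᵘ (¼ * 1/m * o/1)              ≃⟨ toℚᵘ-homo-* (¼ * 1/m) o/1 ⟩
    toℚᵘ (¼ * 1/m) ℚᵘ.* toℚᵘ o/1      ≃⟨ ℚᵘ.*-cong (toℚᵘ-homo-* ¼ 1/m) (toℚᵘ-fromℚᵘ (mkℚᵘ (+ o) 0)) ⟩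
    toℚᵘ ¼ ℚᵘ.* toℚᵘ 1/m ℚᵘ.* mkℚᵘ (+ o) 0
      ≃⟨ ℚᵘ.*-congʳ (ℚᵘ.*-congˡ {toℚᵘ ¼} (toℚᵘ-fromℚᵘ (mkℚᵘ (+ 1) m))) ⟩
    -- The second argument of `mkℚᵘ` is the denominator minus one.
    mkℚᵘ (+ 1) 3 ℚᵘ.* mkℚᵘ (+ 1) m ℚᵘ.* mkℚᵘ (+ o) 0
      ≤⟨ *≤* (subst₂ ℤ._≤_ lhs rhs (ℤ.+≤+ o≤)) ⟩
    mkℚᵘ (+ h) 0                      ≃⟨ toℚᵘ-fromℚᵘ (mkℚᵘ (+ h) 0) ⟨
    toℚᵘ (+ h / 1)                    ∎)
    where
    open ℚᵘ.≤-Reasoning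
    ¼ 1/m o/1 : ℚ
    ¼   = + 1 / 4
    1/m = + 1 / suc m
    o/1 = + o / 1

    lhs : + o ≡ (+ 1 ℤ.* + 1) ℤ.* + o ℤ.* + 1
    lhs = sym (trans (ℤ.*-identityʳ _) (ℤ.*-identityˡ (+ o)))

    rhs : + (h ℕ.* (4 ℕ.* suc m)) ≡ + h ℤ.* + (4 ℕ.* suc m ℕ.* 1)
    rhs = trans (ℤ.pos-* h (4 ℕ.* suc m))
                (cong (λ d → + h ℤ.* + d) (sym (ℕ.*-identityʳ (4 ℕ.* suc m))))

  -- Counting balls of radius 2 loses only a quadratic factor, at most `4 * d ^ 2`; the last step
  -- weakens it to the cube.
  square≤cube : ∀ d {{_ : NonZero d}} → suc d ℕ.* suc d ℕ.≤ 4 ℕ.* d ^ 3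
  square≤cube d = begin
    suc d ℕ.* suc d          ≤⟨ ℕ.*-mono-≤ 1+d≤2d 1+d≤2d ⟩
    (2 ℕ.* d) ℕ.* (2 ℕ.* d)  ≡⟨ ℕ.[m*n]*[o*p]≡[m*o]*[n*p] 2 d 2 d ⟩
    4 ℕ.* (d ℕ.* d)          ≡⟨ cong (λ x → 4 ℕ.* (d ℕ.* x)) (ℕ.*-identityʳ d) ⟨
    4 ℕ.* d ^ 2              ≤⟨ ℕ.*-monoʳ-≤ 4 (ℕ.^-monoʳ-≤ d {2} {3} (ℕ.n≤1+n 2)) ⟩
    4 ℕ.* d ^ 3              ∎
    where
    open ℕ.≤-Reasoning
    1+d≤2d : suc d ℕ.≤ 2 ℕ.* d
    1+d≤2d = ℕ.+-mono-≤ (ℕ.>-nonZero⁻¹ d) (ℕ.m≤m+n d 0)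

open import Data.Integer.Base using (+_)
open import Data.Rational.Base using (ℚ; 0ℚ; _<_; _≤_; _*_; _/_)
open import Data.Nat.Properties using (≤-trans; *-monoʳ-≤)
open import Data.Rational.Properties using (positive⁻¹)
open GreedyProgram using (greedyProgram; greedyProgram-polynomial; greedyProgram-outputs; module Output)
open GreedyBound using (module Approximation)
open Arithmetic

theorem2p3 : ∃[ α ] (0ℚ < α ×
    ∃[ P ] (PolynomialTime encodeMHV P ×
    ((I : MHV) → let open MHV I in
    {{Δ≥1 : NonZero maxDegree}} →
    ∃[ c ] (Outputs P (encodeMHV I) (encodeColouring c) ×
    Extends c ×
    α * ((+ 1) / (maxDegree ^ 3)) {{m^n≢0 maxDegree 3}} * ((+ opt I) / 1)
    ≤ (+ happyCount c) / 1))))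
theorem2p3 =
  (+ 1 / 4) , positive⁻¹ (+ 1 / 4) , greedyProgram ,
  greedyProgram-polynomial ,
  λ I → let open MHV I; open Output I using (output); open Approximation I in
    output ,
    greedyProgram-outputs I ,
    output-extends ,
    quarter-bound (opt I) (happyCount output) (maxDegree ^ 3) {{m^n≢0 maxDegree 3}}
      (≤-trans opt≤ (*-monoʳ-≤ (happyCount output) (square≤cube maxDegree)))
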